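{- Let $H$ be a bipartite graph with $n$ vertices such that every vertex in one part has degree at most $k$ and every vertex in the other part has degree at most $\Delta$. If $G$ is a bipartite graph with edge density $\epsilon$ and at least $16\Delta^{1/k}\epsilon^{ -k}n$ vertices in each part, then $H$ is a subgraph of $G$.
   Context: The edge density of a bipartite graph with parts $A,B$ is $e(A,B)/(|A||B|)$. -}

module Defs where

open import Data.Nat using (ℕ; zero; suc; _+_; _*_)
open import Data.Bool using (Bool; true; false; if_then_else_)
open import Data.Fin using (Fin; zero; suc)
open import Data.Sum using (_⊎_; inj₁; inj₂)
open import Data.Empty using (⊥)
open import Data.Product using (Σ; _×_)
open import Relation.Binary.PropositionalEquality using (_≡_)
open import Function.Definitions using (Injective)

count : (n : ℕ) → (Fin n → Bool) → ℕ
count zero    p = 0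
count (suc n) p = (if p zero then 1 else 0) + count n (λ i → p (suc i))

sumFin : (n : ℕ) → (Fin n → ℕ) → ℕ
sumFin zero    f = 0
sumFin (suc n) f = f zero + sumFin n (λ i → f (suc i))

record BipGraph : Set where
  field
    left  : ℕ
    right : ℕ
    adj   : Fin left → Fin right → Bool

open BipGraph public

Vertex : BipGraph → Set
Vertex G = Fin (left G) ⊎ Fin (right G)

Adj : (G : BipGraph) → Vertex G → Vertex G → Set
Adj G (inj₁ x) (inj₂ y) = adj G x y ≡ true
Adj G (inj₂ y) (inj₁ x) = adj G x y ≡ true
Adj G (inj₁ _) (inj₁ _) = ⊥
Adj G (inj₂ _) (inj₂ _) = ⊥

numVertices : BipGraph → ℕ
numVertices G = left G + right G

degLeft : (G : BipGraph) → Fin (left G) → ℕ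
degLeft G x = count (right G) (λ y → adj G x y)

degRight : (G : BipGraph) → Fin (right G) → ℕ
degRight G y = count (left G) (λ x → adj G x y)

edgeCount : BipGraph → ℕ
edgeCount G = sumFin (left G) (degLeft G)

IsSubgraph : BipGraph → BipGraph → Set
IsSubgraph H G =
  Σ (Vertex H → Vertex G) λ f →
    Injective _≡_ _≡_ f × (∀ u v → Adj H u v → Adj G (f u) (f v))

{-# OPTIONS --safe #-}

-- Dependent random choice combined with a counting proof of the local lemma.
--
-- For a random k-tuple T of right vertices of G let U be its common neighbourhood. Call a tuple of
-- left vertices poor if it has fewer than n common neighbours. The power mean inequality bounds
-- E |U|^k from below, and a poor k-tuple rarely lies in U, so for some T both |U| ≥ 8n holds and
-- the poor k-tuples are at most an 8^(-k)/Δ fraction of U^k.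
--
-- The right side of H (degrees ≤ Δ) goes into U, injectively and so that no left vertex of H has a
-- poor image of its neighbourhood. Let V(S) be the number of maps φ from the right side to U that
-- satisfy these constraints on S. Then V(S) ≤ 2 V(S ∪ {v}) by induction on |S|: a map lost by adding
-- v has a clash at v, or is valid on S ∖ N(x) and makes N(x) poor for some x adjacent to v, and
-- V(S ∖ N(x)) ≤ 2^k V(S) by the induction hypothesis. Hence some φ is valid everywhere, and as every
-- left vertex of H then has at least n candidates, distinct images for them are chosen greedily.
module Submission where

open import Defs
open import Data.Bool using (Bool; true; false; if_then_else_; _∧_; _∨_; not)
open import Data.Bool.ListAction using (all)
import Data.Bool.Properties as Boolₚ
open import Data.Fin using (Fin; zero; suc)
import Data.Fin.Properties as Finₚ
open import Data.List using (List; []; _∷_; _++_; map; length; cartesianProductWith; filterᵇ; tabulate; allFin)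
open import Data.List.Membership.Propositional using (_∈_)
open import Data.List.Membership.Propositional.Properties using (∈-allFin)
open import Data.List.Properties using (length-tabulate; map-∘; map-++; map-cong; map-tabulate)
open import Data.List.Relation.Unary.Any using (here; there)
open import Data.Nat using (ℕ; zero; suc; _+_; _*_; _^_; _∸_; _≤_; _≥_; _<_; _<?_; z≤n; s≤s; s≤s⁻¹; z<s; NonZero; >-nonZero; >-nonZero⁻¹)
open import Data.Nat.ListAction using (sum)
open import Data.Nat.ListAction.Properties using (sum-++)
open import Data.Nat.Properties
open import Data.Nat.Tactic.RingSolver using (solve-∀)
open import Data.Product using (∃; _×_; _,_; proj₁; proj₂)
open import Data.Sum using (_⊎_; inj₁; inj₂)
open import Data.Sum.Properties using (inj₁-injective; inj₂-injective)
open import Data.Vec using (Vec; []; _∷_; toList; lookup)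
import Data.Vec as Vec
open import Data.Vec.Properties using (lookup∘tabulate)
open import Function using (_∘_; id)
open import Relation.Binary.Definitions using (DecidableEquality)
open import Relation.Binary.PropositionalEquality
open import Relation.Nullary using (Dec; yes; no; does; ¬_; contradiction)
open import Relation.Nullary.Decidable using (_×-dec_; _→-dec_; dec-true; dec-false)
open import Algebra.Properties.CommutativeSemigroup +-commutativeSemigroup using () renaming (interchange to +-interchange)
open import Algebra.Properties.CommutativeSemigroup *-commutativeSemigroup using () renaming (interchange to *-interchange; x∙yz≈y∙xz to *-exchange)

-- Finite sums over lists, with Booleans as indicators.

𝟙 : Bool → ℕ
𝟙 b = if b then 1 else 0

𝟙-∧ : ∀ b c → 𝟙 (b ∧ c) ≡ 𝟙 b * 𝟙 c
𝟙-∧ true  c = sym (+-identityʳ (𝟙 c))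
𝟙-∧ false c = refl

module _ {I : Set} where

  ∑ : List I → (I → ℕ) → ℕ
  ∑ xs f = sum (map f xs)

  ∑-cong : ∀ xs {f g : I → ℕ} → (∀ i → f i ≡ g i) → ∑ xs f ≡ ∑ xs g
  ∑-cong xs f≡g = cong sum (map-cong f≡g xs)

  ∑-mono : ∀ xs {f g : I → ℕ} → (∀ i → f i ≤ g i) → ∑ xs f ≤ ∑ xs g
  ∑-mono []       f≤g = z≤n
  ∑-mono (x ∷ xs) f≤g = +-mono-≤ (f≤g x) (∑-mono xs f≤g)

  ∑-+ : ∀ xs (f g : I → ℕ) → ∑ xs (λ i → f i + g i) ≡ ∑ xs f + ∑ xs g
  ∑-+ []       f g = refl
  ∑-+ (x ∷ xs) f g = trans (cong (f x + g x +_) (∑-+ xs f g)) (+-interchange (f x) (g x) _ _)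

  ∑-*ˡ : ∀ xs c (f : I → ℕ) → ∑ xs (λ i → c * f i) ≡ c * ∑ xs f
  ∑-*ˡ []       c f = sym (*-zeroʳ c)
  ∑-*ˡ (x ∷ xs) c f = trans (cong (c * f x +_) (∑-*ˡ xs c f)) (sym (*-distribˡ-+ c (f x) _))

  ∑-*ʳ : ∀ xs c (f : I → ℕ) → ∑ xs (λ i → f i * c) ≡ ∑ xs f * c
  ∑-*ʳ xs c f = trans (∑-cong xs (λ i → *-comm (f i) c)) (trans (∑-*ˡ xs c f) (*-comm c _))

  ∑-const : ∀ xs c → ∑ xs (λ _ → c) ≡ length xs * c
  ∑-const []       c = refl
  ∑-const (x ∷ xs) c = cong (c +_) (∑-const xs c)

  ∑-++ : ∀ xs ys (f : I → ℕ) → ∑ (xs ++ ys) f ≡ ∑ xs f + ∑ ys f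
  ∑-++ xs ys f = trans (cong sum (map-++ f xs ys)) (sum-++ (map f xs) (map f ys))

  ∑-positive : ∀ xs (f : I → ℕ) → 0 < ∑ xs f → ∃ λ i → 0 < f i
  ∑-positive (x ∷ xs) f 0<∑ with f x in eq
  ... | suc m = x , subst (0 <_) (sym eq) z<s
  ... | zero  = ∑-positive xs f 0<∑

  ∑-filter : ∀ xs p (f : I → ℕ) → ∑ (filterᵇ p xs) f ≡ ∑ xs (λ i → 𝟙 (p i) * f i)
  ∑-filter []       p f = refl
  ∑-filter (x ∷ xs) p f with p x
  ... | true  = cong₂ _+_ (sym (+-identityʳ (f x))) (∑-filter xs p f)
  ... | false = ∑-filter xs p f

  length-filter : ∀ xs (p : I → Bool) → length (filterᵇ p xs) ≡ ∑ xs (𝟙 ∘ p)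
  length-filter []       p = refl
  length-filter (x ∷ xs) p with p x
  ... | true  = cong suc (length-filter xs p)
  ... | false = length-filter xs p

  -- The truncated differences `suc (g i) ∸ f i` add up to at least the length of `xs`, so one of
  -- them is positive. The `suc` is what turns the resulting `f i < suc (g i)` into the claim.
  ∑-average : ∀ xs (f g : I → ℕ) → 0 < length xs → ∑ xs f ≤ ∑ xs g → ∃ λ i → f i ≤ g i
  ∑-average xs f g 0<n ∑f≤∑g with ∑-positive xs (λ i → suc (g i) ∸ f i) excess
    where
    open ≤-Reasoning
    excess : 0 < ∑ xs (λ i → suc (g i) ∸ f i)
    excess = ≤-trans 0<n (+-cancelˡ-≤ (∑ xs g) _ _ (begin
      ∑ xs g + length xs                           ≡⟨ cong (∑ xs g +_) (trans (sym (*-identityʳ _)) (sym (∑-const xs 1))) ⟩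
      ∑ xs g + ∑ xs (λ _ → 1)                      ≡⟨ sym (∑-+ xs g (λ _ → 1)) ⟩
      ∑ xs (λ i → g i + 1)                         ≤⟨ ∑-mono xs (λ i → ≤-trans (≤-reflexive (+-comm (g i) 1)) (m≤n+m∸n (suc (g i)) (f i))) ⟩
      ∑ xs (λ i → f i + (suc (g i) ∸ f i))         ≡⟨ ∑-+ xs f _ ⟩
      ∑ xs f + ∑ xs (λ i → suc (g i) ∸ f i)        ≤⟨ +-monoˡ-≤ _ ∑f≤∑g ⟩
      ∑ xs g + ∑ xs (λ i → suc (g i) ∸ f i)        ∎))
  ... | i , 0<d = i , s≤s⁻¹ (m∸n≢0⇒n<m (>⇒≢ 0<d))

∑-map : ∀ {I J : Set} (h : I → J) xs (f : J → ℕ) → ∑ (map h xs) f ≡ ∑ xs (f ∘ h)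
∑-map h xs f = cong sum (sym (map-∘ xs))

∑-swap : ∀ {I J : Set} xs ys (f : I → J → ℕ) →
         ∑ xs (λ i → ∑ ys (λ j → f i j)) ≡ ∑ ys (λ j → ∑ xs (λ i → f i j))
∑-swap []       ys f = sym (trans (∑-const ys 0) (*-zeroʳ (length ys)))
∑-swap (x ∷ xs) ys f = trans (cong (∑ ys (f x) +_) (∑-swap xs ys f)) (sym (∑-+ ys (f x) _))

∑-cartesian : ∀ {I J K : Set} (h : I → J → K) xs ys (f : K → ℕ) →
              ∑ (cartesianProductWith h xs ys) f ≡ ∑ xs (λ i → ∑ ys (λ j → f (h i j)))
∑-cartesian h []       ys f = refl
∑-cartesian h (x ∷ xs) ys f =
  trans (∑-++ (map (h x) ys) _ f) (cong₂ _+_ (∑-map (h x) ys f) (∑-cartesian h xs ys f))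

-- The power mean inequality over the naturals.

-- Writing `y` as `x + d` and `y ^ k` as `x ^ k + c`, the two sides differ by exactly `d * c`.
rearrangement-≤ : ∀ k {x y} → x ≤ y → y * x ^ k + x * y ^ k ≤ y ^ suc k + x ^ suc k
rearrangement-≤ k {x} x≤y with m≤n⇒∃[o]m+o≡n x≤y | m≤n⇒∃[o]m+o≡n (^-monoˡ-≤ k x≤y)
... | d , refl | c , eq rewrite sym eq =
  subst ((x + d) * x ^ k + x * (x ^ k + c) ≤_) (identity x d (x ^ k) c) (m≤m+n _ (d * c))
  where
  identity : ∀ x d p c → ((x + d) * p + x * (p + c)) + d * c ≡ (x + d) * (p + c) + x * p
  identity = solve-∀

rearrangement : ∀ k x y → x * y ^ k + y * x ^ k ≤ x ^ suc k + y ^ suc k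
rearrangement k x y with ≤-total x y
... | inj₁ x≤y = subst₂ _≤_ (+-comm (y * x ^ k) _) (+-comm (y ^ suc k) _) (rearrangement-≤ k x≤y)
... | inj₂ y≤x = rearrangement-≤ k y≤x

-- Chebyshev's sum inequality for the similarly ordered families `f` and `f ^ k`: the doubled
-- product is a double sum over pairs `i`, `j` in both orders, and `rearrangement` applies to each
-- pair.
chebyshev : ∀ {I : Set} (xs : List I) f k →
            ∑ xs f * ∑ xs (λ i → f i ^ k) ≤ length xs * ∑ xs (λ i → f i ^ suc k)
chebyshev xs f k = *-cancelˡ-≤ 2 (begin
  2 * (S * Sₖ)                                                          ≡⟨ double (S * Sₖ) ⟩
  S * Sₖ + S * Sₖ                                                       ≡⟨ cong₂ _+_ product₁ product₂ ⟩
  ∑ xs (λ i → ∑ xs (λ j → f i * f j ^ k)) + ∑ xs (λ i → ∑ xs (λ j → f j * f i ^ k)) ≡⟨ sym (∑-+ xs _ _) ⟩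
  ∑ xs (λ i → ∑ xs (λ j → f i * f j ^ k) + ∑ xs (λ j → f j * f i ^ k))  ≡⟨ ∑-cong xs (λ i → sym (∑-+ xs _ _)) ⟩
  ∑ xs (λ i → ∑ xs (λ j → f i * f j ^ k + f j * f i ^ k))               ≤⟨ ∑-mono xs (λ i → ∑-mono xs (λ j → rearrangement k (f i) (f j))) ⟩
  ∑ xs (λ i → ∑ xs (λ j → f i ^ suc k + f j ^ suc k))                   ≡⟨ ∑-cong xs (λ i → ∑-+ xs _ _) ⟩
  ∑ xs (λ i → ∑ xs (λ j → f i ^ suc k) + Sₖ₊₁)                          ≡⟨ ∑-+ xs _ _ ⟩
  ∑ xs (λ i → ∑ xs (λ j → f i ^ suc k)) + ∑ xs (λ i → Sₖ₊₁)             ≡⟨ cong₂ _+_ (∑-cong xs (λ i → ∑-const xs _)) (∑-const xs _) ⟩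
  ∑ xs (λ i → length xs * f i ^ suc k) + length xs * Sₖ₊₁               ≡⟨ cong (_+ length xs * Sₖ₊₁) (∑-*ˡ xs (length xs) _) ⟩
  length xs * Sₖ₊₁ + length xs * Sₖ₊₁                                   ≡⟨ sym (double (length xs * Sₖ₊₁)) ⟩
  2 * (length xs * Sₖ₊₁)                                                ∎)
  where
  open ≤-Reasoning
  S    = ∑ xs f
  Sₖ   = ∑ xs (λ i → f i ^ k)
  Sₖ₊₁ = ∑ xs (λ i → f i ^ suc k)
  double : ∀ m → 2 * m ≡ m + m
  double = solve-∀
  product₁ : S * Sₖ ≡ ∑ xs (λ i → ∑ xs (λ j → f i * f j ^ k))
  product₁ = trans (sym (∑-*ʳ xs Sₖ f)) (∑-cong xs (λ i → sym (∑-*ˡ xs (f i) _)))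
  product₂ : S * Sₖ ≡ ∑ xs (λ i → ∑ xs (λ j → f j * f i ^ k))
  product₂ = trans (sym (∑-*ˡ xs S _)) (∑-cong xs (λ i → sym (∑-*ʳ xs (f i ^ k) f)))

-- Convexity with denominators cleared. Each induction step uses `chebyshev` to trade one factor
-- `∑ xs f` for a factor `length xs`.
power-mean : ∀ {I : Set} (xs : List I) f k →
             ∑ xs f ^ suc k ≤ length xs ^ k * ∑ xs (λ i → f i ^ suc k)
power-mean xs f zero    = ≤-reflexive (trans (*-identityʳ _) (trans (∑-cong xs (λ i → sym (*-identityʳ (f i)))) (sym (+-identityʳ _))))
power-mean xs f (suc k) = begin
  S * S ^ suc k                        ≤⟨ *-monoʳ-≤ S (power-mean xs f k) ⟩
  S * (n ^ k * Σf 1+k)                 ≡⟨ *-exchange S (n ^ k) _ ⟩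
  n ^ k * (S * Σf 1+k)                 ≤⟨ *-monoʳ-≤ (n ^ k) (chebyshev xs f 1+k) ⟩
  n ^ k * (n * Σf (suc 1+k))           ≡⟨ *-exchange (n ^ k) n _ ⟩
  n * (n ^ k * Σf (suc 1+k))           ≡⟨ sym (*-assoc n (n ^ k) _) ⟩
  n * n ^ k * Σf (suc 1+k)             ∎
  where
  open ≤-Reasoning
  S   = ∑ xs f
  n   = length xs
  1+k = suc k
  Σf : ℕ → ℕ
  Σf m = ∑ xs (λ i → f i ^ m)

-- Recursive counts as list sums.

sum-tabulate : ∀ n (f : Fin n → ℕ) → sumFin n f ≡ sum (tabulate f)
sum-tabulate zero    f = refl
sum-tabulate (suc n) f = cong (f zero +_) (sum-tabulate n (f ∘ suc))

sumFin≡∑ : ∀ n f → sumFin n f ≡ ∑ (allFin n) f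
sumFin≡∑ n f = trans (sum-tabulate n f) (cong sum (sym (map-tabulate id f)))

count≡sumFin : ∀ n p → count n p ≡ sumFin n (𝟙 ∘ p)
count≡sumFin zero    p = refl
count≡sumFin (suc n) p = cong (𝟙 (p zero) +_) (count≡sumFin n (p ∘ suc))

count≡∑ : ∀ n p → count n p ≡ ∑ (allFin n) (𝟙 ∘ p)
count≡∑ n p = trans (count≡sumFin n p) (sumFin≡∑ n (𝟙 ∘ p))

-- Sums over all tuples.

-- The sample space of `k` independent uniform choices from `xs`. Probabilities appear below as sums
-- over it, multiplied out by its size.
tuples : ∀ {A : Set} k → List A → List (Vec A k)
tuples zero    xs = [] ∷ []
tuples (suc k) xs = cartesianProductWith _∷_ xs (tuples k xs)

module _ {A : Set} where

  ∑-tuples-suc : ∀ k (xs : List A) f →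
                 ∑ (tuples (suc k) xs) f ≡ ∑ xs (λ a → ∑ (tuples k xs) (λ t → f (a ∷ t)))
  ∑-tuples-suc k xs f = ∑-cartesian _∷_ xs (tuples k xs) f

  ∑-tuples-all : ∀ k (xs : List A) p →
                 ∑ (tuples k xs) (λ t → 𝟙 (all p (toList t))) ≡ ∑ xs (𝟙 ∘ p) ^ k
  ∑-tuples-all zero    xs p = refl
  ∑-tuples-all (suc k) xs p = begin
    ∑ (tuples (suc k) xs) (λ t → 𝟙 (all p (toList t)))                 ≡⟨ ∑-tuples-suc k xs _ ⟩
    ∑ xs (λ a → ∑ (tuples k xs) (λ t → 𝟙 (p a ∧ all p (toList t))))    ≡⟨ ∑-cong xs (λ a → trans (∑-cong (tuples k xs) (λ t → 𝟙-∧ (p a) _)) (∑-*ˡ (tuples k xs) (𝟙 (p a)) _)) ⟩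
    ∑ xs (λ a → 𝟙 (p a) * ∑ (tuples k xs) (λ t → 𝟙 (all p (toList t)))) ≡⟨ ∑-*ʳ xs _ (𝟙 ∘ p) ⟩
    ∑ xs (𝟙 ∘ p) * ∑ (tuples k xs) (λ t → 𝟙 (all p (toList t)))        ≡⟨ cong (∑ xs (𝟙 ∘ p) *_) (∑-tuples-all k xs p) ⟩
    ∑ xs (𝟙 ∘ p) * ∑ xs (𝟙 ∘ p) ^ k                                    ∎
    where open ≡-Reasoning

  -- Moves the dependence on `p` from the range of summation into the summand, so that a sum over
  -- tuples from `common T` can be interchanged with a sum over `T`.
  ∑-tuples-filter : ∀ k (xs : List A) p (f : Vec A k → ℕ) →
                    ∑ (tuples k (filterᵇ p xs)) f ≡ ∑ (tuples k xs) (λ t → 𝟙 (all p (toList t)) * f t)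
  ∑-tuples-filter zero    xs p f = cong (_+ 0) (sym (+-identityʳ (f [])))
  ∑-tuples-filter (suc k) xs p f = begin
    ∑ (tuples (suc k) (filterᵇ p xs)) f                                                     ≡⟨ ∑-tuples-suc k (filterᵇ p xs) f ⟩
    ∑ (filterᵇ p xs) (λ a → ∑ (tuples k (filterᵇ p xs)) (λ t → f (a ∷ t)))                   ≡⟨ ∑-filter xs p _ ⟩
    ∑ xs (λ a → 𝟙 (p a) * ∑ (tuples k (filterᵇ p xs)) (λ t → f (a ∷ t)))                     ≡⟨ ∑-cong xs (λ a → cong (𝟙 (p a) *_) (∑-tuples-filter k xs p (λ t → f (a ∷ t)))) ⟩
    ∑ xs (λ a → 𝟙 (p a) * ∑ (tuples k xs) (λ t → 𝟙 (all p (toList t)) * f (a ∷ t)))          ≡⟨ ∑-cong xs (λ a → sym (∑-*ˡ (tuples k xs) (𝟙 (p a)) _)) ⟩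
    ∑ xs (λ a → ∑ (tuples k xs) (λ t → 𝟙 (p a) * (𝟙 (all p (toList t)) * f (a ∷ t))))        ≡⟨ ∑-cong xs (λ a → ∑-cong (tuples k xs) (λ t → trans (sym (*-assoc (𝟙 (p a)) _ _)) (cong (_* f (a ∷ t)) (sym (𝟙-∧ (p a) _))))) ⟩
    ∑ xs (λ a → ∑ (tuples k xs) (λ t → 𝟙 (p a ∧ all p (toList t)) * f (a ∷ t)))              ≡⟨ sym (∑-tuples-suc k xs _) ⟩
    ∑ (tuples (suc k) xs) (λ t → 𝟙 (all p (toList t)) * f t)                                ∎
    where open ≡-Reasoning

  ∑-tuples-const : ∀ k (xs : List A) c → ∑ (tuples k xs) (λ _ → c) ≡ length xs ^ k * c
  ∑-tuples-const zero    xs c = refl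
  ∑-tuples-const (suc k) xs c = begin
    ∑ (tuples (suc k) xs) (λ _ → c)             ≡⟨ ∑-tuples-suc k xs _ ⟩
    ∑ xs (λ _ → ∑ (tuples k xs) (λ _ → c))      ≡⟨ ∑-const xs _ ⟩
    length xs * ∑ (tuples k xs) (λ _ → c)       ≡⟨ cong (length xs *_) (∑-tuples-const k xs c) ⟩
    length xs * (length xs ^ k * c)             ≡⟨ sym (*-assoc (length xs) _ c) ⟩
    length xs * length xs ^ k * c               ∎
    where open ≡-Reasoning

  length-tuples : ∀ k (xs : List A) → length (tuples k xs) ≡ length xs ^ k
  length-tuples k xs = *-cancelʳ-≡ _ _ 1 (trans (sym (∑-const (tuples k xs) 1)) (∑-tuples-const k xs 1))

  -- One coordinate of a uniform tuple is uniform. The factor `length xs` on the left avoids the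
  -- exponent `r - 1` on the right.
  ∑-tuples-lookup : ∀ r (xs : List A) (v : Fin r) f →
                    length xs * ∑ (tuples r xs) (λ t → f (lookup t v)) ≡ length xs ^ r * ∑ xs f
  ∑-tuples-lookup (suc r) xs zero f = begin
    n * ∑ (tuples (suc r) xs) (λ t → f (lookup t zero))   ≡⟨ cong (n *_) (∑-tuples-suc r xs _) ⟩
    n * ∑ xs (λ a → ∑ (tuples r xs) (λ t → f a))          ≡⟨ cong (n *_) (∑-cong xs (λ a → ∑-tuples-const r xs (f a))) ⟩
    n * ∑ xs (λ a → n ^ r * f a)                          ≡⟨ cong (n *_) (∑-*ˡ xs (n ^ r) f) ⟩
    n * (n ^ r * ∑ xs f)                                  ≡⟨ sym (*-assoc n (n ^ r) _) ⟩
    n * n ^ r * ∑ xs f                                    ∎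
    where open ≡-Reasoning
          n = length xs
  ∑-tuples-lookup (suc r) xs (suc v) f = begin
    n * ∑ (tuples (suc r) xs) (λ t → f (lookup t (suc v)))        ≡⟨ cong (n *_) (∑-tuples-suc r xs _) ⟩
    n * ∑ xs (λ a → ∑ (tuples r xs) (λ t → f (lookup t v)))       ≡⟨ cong (n *_) (∑-const xs _) ⟩
    n * (n * ∑ (tuples r xs) (λ t → f (lookup t v)))              ≡⟨ cong (n *_) (∑-tuples-lookup r xs v f) ⟩
    n * (n ^ r * ∑ xs f)                                          ≡⟨ sym (*-assoc n (n ^ r) _) ⟩
    n * n ^ r * ∑ xs f                                            ∎
    where open ≡-Reasoning
          n = length xs

-- Decidable events, and finite sets as Boolean predicates.

𝟙-mono : ∀ {P Q : Set} (p : Dec P) (q : Dec Q) → (P → Q) → 𝟙 (does p) ≤ 𝟙 (does q)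
𝟙-mono (no  _) q       P→Q = z≤n
𝟙-mono (yes p) (yes q) P→Q = ≤-refl
𝟙-mono (yes p) (no ¬q) P→Q = contradiction (P→Q p) ¬q

𝟙-positive : ∀ {P : Set} (p : Dec P) → 0 < 𝟙 (does p) → P
𝟙-positive (yes p) _ = p

∑-member : ∀ {I : Set} {xs : List I} {i} (f : I → ℕ) → i ∈ xs → f i ≤ ∑ xs f
∑-member f (here refl)  = m≤m+n (f _) _
∑-member f (there i∈xs) = ≤-trans (∑-member f i∈xs) (m≤n+m _ (f _))

infix 4 _⊆_
_⊆_ : ∀ {n} → (Fin n → Bool) → (Fin n → Bool) → Set
S ⊆ S′ = ∀ u → S u ≡ true → S′ u ≡ true

count-mono : ∀ n {S S′ : Fin n → Bool} → S ⊆ S′ → count n S ≤ count n S′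
count-mono zero                S⊆S′ = z≤n
count-mono (suc n) {S} {S′} S⊆S′ = +-mono-≤ (𝟙-≤ (S⊆S′ zero)) (count-mono n (S⊆S′ ∘ suc))
  where
  𝟙-≤ : ∀ {b c} → (b ≡ true → c ≡ true) → 𝟙 b ≤ 𝟙 c
  𝟙-≤ {false} b→c = z≤n
  𝟙-≤ {true}  b→c rewrite b→c refl = ≤-refl

count-mono-< : ∀ n {S S′ : Fin n → Bool} → S ⊆ S′ → ∀ v → S v ≡ false → S′ v ≡ true → count n S < count n S′
count-mono-< (suc n) S⊆S′ zero v∉S v∈S′ rewrite v∉S | v∈S′ = s≤s (count-mono n (S⊆S′ ∘ suc))
count-mono-< (suc n) {S} {S′} S⊆S′ (suc v) v∉S v∈S′ with S zero | S′ zero | S⊆S′ zero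
... | false | false | _ = count-mono-< n (S⊆S′ ∘ suc) v v∉S v∈S′
... | false | true  | _ = s≤s (<⇒≤ (count-mono-< n (S⊆S′ ∘ suc) v v∉S v∈S′))
... | true  | true  | _ = s≤s (count-mono-< n (S⊆S′ ∘ suc) v v∉S v∈S′)
... | true  | false | h = contradiction (h refl) λ ()

infixl 6 _∖_
_∖_ : ∀ {n} → (Fin n → Bool) → (Fin n → Bool) → Fin n → Bool
(S ∖ e) u = S u ∧ not (e u)

∖-⊆ : ∀ {n} (S e : Fin n → Bool) → S ∖ e ⊆ S
∖-⊆ S e u h with S u
... | true = refl

∈-∖⇒∉ : ∀ {n} (S e : Fin n → Bool) u → (S ∖ e) u ≡ true → e u ≡ false
∈-∖⇒∉ S e u h with S u | e u
... | true | false = refl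

count-∖ : ∀ n (S e : Fin n → Bool) → count n S ≤ count n e + count n (S ∖ e)
count-∖ zero    S e = z≤n
count-∖ (suc n) S e with S zero | e zero | count-∖ n (S ∘ suc) (e ∘ suc)
... | false | false | IH = IH
... | false | true  | IH = ≤-trans IH (n≤1+n _)
... | true  | true  | IH = s≤s IH
... | true  | false | IH = ≤-trans (s≤s IH) (≤-reflexive (sym (+-suc _ _)))

insert : ∀ {n} → Fin n → (Fin n → Bool) → Fin n → Bool
insert v S u = does (u Finₚ.≟ v) ∨ S u

∈-insert⁻ : ∀ {n} (v : Fin n) S u → insert v S u ≡ true → u ≡ v ⊎ S u ≡ true
∈-insert⁻ v S u h with u Finₚ.≟ v
... | yes u≡v = inj₁ u≡v
... | no  _   = inj₂ h

insert-self : ∀ {n} (v : Fin n) S → insert v S v ≡ true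
insert-self v S rewrite dec-true (v Finₚ.≟ v) refl = refl

insert-⊇ : ∀ {n} (v : Fin n) S → S ⊆ insert v S
insert-⊇ v S u u∈S rewrite u∈S = Boolₚ.∨-zeroʳ _

-- Resampling and restricting coordinates of a tuple.

module _ {A : Set} where

  merge : ∀ {r} → (Fin r → Bool) → Vec A r → Vec A r → Vec A r
  merge e φ ψ = Vec.tabulate (λ i → if e i then lookup ψ i else lookup φ i)

  lookup-merge-∈ : ∀ {r} (e : Fin r → Bool) φ ψ {i} → e i ≡ true → lookup (merge e φ ψ) i ≡ lookup ψ i
  lookup-merge-∈ e φ ψ {i} i∈e = trans (lookup∘tabulate _ i) (cong (if_then lookup ψ i else lookup φ i) i∈e)

  lookup-merge-∉ : ∀ {r} (e : Fin r → Bool) φ ψ {i} → e i ≡ false → lookup (merge e φ ψ) i ≡ lookup φ i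
  lookup-merge-∉ e φ ψ {i} i∉e = trans (lookup∘tabulate _ i) (cong (if_then lookup ψ i else lookup φ i) i∉e)

  -- Stands in for independence: resampling the coordinates in e preserves the uniform distribution.
  ∑-merge : ∀ r (xs : List A) (e : Fin r → Bool) (F : Vec A r → ℕ) →
            ∑ (tuples r xs) (λ φ → ∑ (tuples r xs) (λ ψ → F (merge e φ ψ))) ≡ length xs ^ r * ∑ (tuples r xs) F
  ∑-merge zero    xs e F = refl
  ∑-merge (suc r) xs e F = begin
    ∑ (tuples (suc r) xs) (λ φ → ∑ (tuples (suc r) xs) (λ ψ → F (merge e φ ψ)))      ≡⟨ ∑-tuples-suc r xs _ ⟩
    ∑ xs (λ a → ∑ Ω (λ φ → ∑ (tuples (suc r) xs) (λ ψ → F (merge e (a ∷ φ) ψ))))     ≡⟨ ∑-cong xs (λ a → ∑-cong Ω (λ φ → ∑-tuples-suc r xs _)) ⟩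
    ∑ xs (λ a → ∑ Ω (λ φ → ∑ xs (λ b → ∑ Ω (λ ψ → F (merge e (a ∷ φ) (b ∷ ψ))))))    ≡⟨ first (e zero) ⟩
    n * ∑ xs (λ a → ∑ Ω (λ φ → ∑ Ω (λ ψ → F (a ∷ merge (e ∘ suc) φ ψ))))             ≡⟨ cong (n *_) (∑-cong xs (λ a → ∑-merge r xs (e ∘ suc) (F ∘ (a ∷_)))) ⟩
    n * ∑ xs (λ a → n ^ r * ∑ Ω (λ φ → F (a ∷ φ)))                                   ≡⟨ cong (n *_) (∑-*ˡ xs (n ^ r) _) ⟩
    n * (n ^ r * ∑ xs (λ a → ∑ Ω (λ φ → F (a ∷ φ))))                                 ≡⟨ sym (*-assoc n (n ^ r) _) ⟩
    n ^ suc r * ∑ xs (λ a → ∑ Ω (λ φ → F (a ∷ φ)))                                   ≡⟨ cong (n ^ suc r *_) (sym (∑-tuples-suc r xs F)) ⟩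
    n ^ suc r * ∑ (tuples (suc r) xs) F                                              ∎
    where
    open ≡-Reasoning
    n = length xs
    Ω = tuples r xs
    first : ∀ c → ∑ xs (λ a → ∑ Ω (λ φ → ∑ xs (λ b → ∑ Ω (λ ψ → F ((if c then b else a) ∷ merge (e ∘ suc) φ ψ)))))
                  ≡ n * ∑ xs (λ a → ∑ Ω (λ φ → ∑ Ω (λ ψ → F (a ∷ merge (e ∘ suc) φ ψ))))
    first true  = trans (∑-const xs _) (cong (n *_) (∑-swap Ω xs _))
    first false = trans (∑-cong xs (λ a → trans (∑-cong Ω (λ φ → ∑-const xs _)) (∑-*ˡ Ω n _))) (∑-*ˡ xs n _)

  -- A list, not a vector, so that a single predicate covers images of neighbourhoods of every size.
  select : ∀ {r} → (Fin r → Bool) → Vec A r → List A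
  select {zero}  e []      = []
  select {suc r} e (a ∷ φ) = if e zero then a ∷ select (e ∘ suc) φ else select (e ∘ suc) φ

  select-cong : ∀ {r} (e : Fin r → Bool) φ ψ → (∀ u → e u ≡ true → lookup φ u ≡ lookup ψ u) → select e φ ≡ select e ψ
  select-cong {zero}  e []      []      φ≡ψ = refl
  select-cong {suc r} e (a ∷ φ) (b ∷ ψ) φ≡ψ with e zero | φ≡ψ zero
  ... | true  | a≡b = cong₂ _∷_ (a≡b refl) (select-cong (e ∘ suc) φ ψ (φ≡ψ ∘ suc))
  ... | false | _   = select-cong (e ∘ suc) φ ψ (φ≡ψ ∘ suc)

  select-∅ : ∀ {r} (e : Fin r → Bool) φ → (∀ u → e u ≡ false) → select e φ ≡ []
  select-∅ {zero}  e []      e≡∅ = refl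
  select-∅ {suc r} e (a ∷ φ) e≡∅ rewrite e≡∅ zero = select-∅ (e ∘ suc) φ (e≡∅ ∘ suc)

  -- The coordinates in `e` form a uniform tuple of length `count r e`. Padding it with arbitrary
  -- entries to length `k` can only increase `f`, so the average of `f` on the image of `e` is at
  -- most its average over `k`-tuples.
  ∑-select : ∀ r (xs : List A) (e : Fin r → Bool) k (f : List A → ℕ) →
             (∀ l l′ → f l ≤ f (l ++ l′)) → count r e ≤ k →
             length xs ^ k * ∑ (tuples r xs) (f ∘ select e) ≤ length xs ^ r * ∑ (tuples k xs) (f ∘ toList)
  -- Here `k` is the number of padding entries still to be filled.
  ∑-select zero xs e k f f-++ |e|≤k = begin
    n ^ k * (f [] + 0)                   ≡⟨ cong (n ^ k *_) (+-identityʳ (f [])) ⟩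
    n ^ k * f []                         ≡⟨ sym (∑-tuples-const k xs (f [])) ⟩
    ∑ (tuples k xs) (λ _ → f [])         ≤⟨ ∑-mono (tuples k xs) (λ t → f-++ [] (toList t)) ⟩
    ∑ (tuples k xs) (f ∘ toList)         ≡⟨ sym (*-identityˡ _) ⟩
    1 * ∑ (tuples k xs) (f ∘ toList)     ∎
    where open ≤-Reasoning
          n = length xs
  ∑-select (suc r) xs e k f f-++ |e|≤k = ≤-trans (≤-reflexive (cong (n ^ k *_) (∑-tuples-suc r xs _))) (step (e zero) k |e|≤k)
    where
    open ≤-Reasoning
    n = length xs
    s = select (e ∘ suc)
    step : ∀ c k → (if c then 1 else 0) + count r (e ∘ suc) ≤ k →
           n ^ k * ∑ xs (λ a → ∑ (tuples r xs) (λ φ → f (if c then a ∷ s φ else s φ))) ≤ n ^ suc r * ∑ (tuples k xs) (f ∘ toList)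
    step false k |e|≤k = begin
      n ^ k * ∑ xs (λ a → ∑ (tuples r xs) (f ∘ s))       ≡⟨ cong (n ^ k *_) (∑-const xs _) ⟩
      n ^ k * (n * ∑ (tuples r xs) (f ∘ s))              ≡⟨ *-exchange (n ^ k) n _ ⟩
      n * (n ^ k * ∑ (tuples r xs) (f ∘ s))              ≤⟨ *-monoʳ-≤ n (∑-select r xs (e ∘ suc) k f f-++ |e|≤k) ⟩
      n * (n ^ r * ∑ (tuples k xs) (f ∘ toList))         ≡⟨ sym (*-assoc n (n ^ r) _) ⟩
      n ^ suc r * ∑ (tuples k xs) (f ∘ toList)           ∎
    step true (suc k) (s≤s |e|≤k) = begin
      n ^ suc k * ∑ xs (λ a → ∑ (tuples r xs) (λ φ → f (a ∷ s φ)))           ≡⟨ *-assoc n (n ^ k) _ ⟩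
      n * (n ^ k * ∑ xs (λ a → ∑ (tuples r xs) (λ φ → f (a ∷ s φ))))         ≡⟨ cong (n *_) (sym (∑-*ˡ xs (n ^ k) _)) ⟩
      n * ∑ xs (λ a → n ^ k * ∑ (tuples r xs) (λ φ → f (a ∷ s φ)))           ≤⟨ *-monoʳ-≤ n (∑-mono xs (λ a → ∑-select r xs (e ∘ suc) k (f ∘ (a ∷_)) (f-++ ∘ (a ∷_)) |e|≤k)) ⟩
      n * ∑ xs (λ a → n ^ r * ∑ (tuples k xs) (λ t → f (a ∷ toList t)))      ≡⟨ cong (n *_) (∑-*ˡ xs (n ^ r) _) ⟩
      n * (n ^ r * ∑ xs (λ a → ∑ (tuples k xs) (λ t → f (a ∷ toList t))))    ≡⟨ sym (*-assoc n (n ^ r) _) ⟩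
      n ^ suc r * ∑ xs (λ a → ∑ (tuples k xs) (λ t → f (a ∷ toList t)))      ≡⟨ cong (n ^ suc r *_) (sym (∑-tuples-suc k xs _)) ⟩
      n ^ suc r * ∑ (tuples (suc k) xs) (f ∘ toList)                         ∎

-- The local lemma by counting.

4*2ᵏ≤8ᵏ : ∀ k → 1 ≤ k → 4 * 2 ^ k ≤ 8 ^ k
4*2ᵏ≤8ᵏ (suc j) _ = ≤-trans (≤-reflexive (sym (*-assoc 4 2 (2 ^ j)))) (*-monoʳ-≤ 8 (^-monoˡ-≤ j (m≤m+n 2 6)))

-- `large` and `rare` are tuned so that, when a vertex is added, clashes and bad neighbourhoods each
-- cost at most a quarter of the valid maps. `bad-++` is the monotonicity that `∑-select` needs for
-- padding.
module Counting
  {A : Set} (_≟_ : DecidableEquality A) (U : List A)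
  (U-simple : ∀ b → ∑ U (λ a → 𝟙 (does (a ≟ b))) ≤ 1)
  (bad : List A → Bool) (bad-[] : bad [] ≡ false) (bad-++ : ∀ l l′ → 𝟙 (bad l) ≤ 𝟙 (bad (l ++ l′)))
  {L R : ℕ} (N : Fin L → Fin R → Bool) (k Δ : ℕ) (1≤k : 1 ≤ k)
  (degL : ∀ x → count R (N x) ≤ k) (degR : ∀ v → count L (λ x → N x v) ≤ Δ)
  (large : 4 * R ≤ length U)
  (rare : 8 ^ k * (Δ * ∑ (tuples k U) (𝟙 ∘ bad ∘ toList)) ≤ length U ^ k)
  where

  W X : ℕ
  W = length U
  X = ∑ (tuples k U) (𝟙 ∘ bad ∘ toList)

  Ω : List (Vec A R)
  Ω = tuples R U

  -- The maps are total, so `V` counts within one sample space for every `S`. A left vertex imposes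
  -- its constraint only once its whole neighbourhood lies in `S`; hence validity is antitone in `S`
  -- and depends only on the values on `S`.
  Valid : (Fin R → Bool) → Vec A R → Set
  Valid S φ = (∀ u u′ → S u ≡ true → S u′ ≡ true → lookup φ u ≡ lookup φ u′ → u ≡ u′)
            × (∀ x → N x ⊆ S → bad (select (N x) φ) ≡ false)

  valid? : ∀ S φ → Dec (Valid S φ)
  valid? S φ =
    Finₚ.all? (λ u → Finₚ.all? (λ u′ → (S u Boolₚ.≟ true) →-dec ((S u′ Boolₚ.≟ true) →-dec ((lookup φ u ≟ lookup φ u′) →-dec (u Finₚ.≟ u′)))))
    ×-dec Finₚ.all? (λ x → Finₚ.all? (λ u → (N x u Boolₚ.≟ true) →-dec (S u Boolₚ.≟ true)) →-dec (bad (select (N x) φ) Boolₚ.≟ false))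

  χ : (Fin R → Bool) → Vec A R → ℕ
  χ S φ = 𝟙 (does (valid? S φ))

  V : (Fin R → Bool) → ℕ
  V S = ∑ Ω (χ S)

  Valid-anti : ∀ {S S′} φ → S ⊆ S′ → Valid S′ φ → Valid S φ
  Valid-anti φ S⊆S′ (inj , good) = (λ u u′ u∈S u′∈S → inj u u′ (S⊆S′ u u∈S) (S⊆S′ u′ u′∈S))
                                  , (λ x Nx⊆S → good x (λ u → S⊆S′ u ∘ Nx⊆S u))

  χ-anti : ∀ {S S′} φ → S ⊆ S′ → χ S′ φ ≤ χ S φ
  χ-anti {S} {S′} φ S⊆S′ = 𝟙-mono (valid? S′ φ) (valid? S φ) (Valid-anti φ S⊆S′)

  V-anti : ∀ {S S′} → S ⊆ S′ → V S′ ≤ V S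
  V-anti S⊆S′ = ∑-mono Ω (λ φ → χ-anti φ S⊆S′)

  Valid-local : ∀ {S} φ ψ → (∀ u → S u ≡ true → lookup φ u ≡ lookup ψ u) → Valid S φ → Valid S ψ
  Valid-local φ ψ φ≡ψ (inj , good) =
      (λ u u′ u∈S u′∈S eq → inj u u′ u∈S u′∈S (trans (φ≡ψ u u∈S) (trans eq (sym (φ≡ψ u′ u′∈S)))))
    , (λ x Nx⊆S → trans (cong bad (sym (select-cong (N x) φ ψ (λ u → φ≡ψ u ∘ Nx⊆S u)))) (good x Nx⊆S))

  χ-local : ∀ {S} φ ψ → (∀ u → S u ≡ true → lookup φ u ≡ lookup ψ u) → χ S φ ≤ χ S ψ
  χ-local {S} φ ψ φ≡ψ = 𝟙-mono (valid? S φ) (valid? S ψ) (Valid-local φ ψ φ≡ψ)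

  clash : (Fin R → Bool) → Fin R → Fin R → Vec A R → ℕ
  clash S v u φ = χ S φ * (𝟙 (S u) * 𝟙 (does (lookup φ v ≟ lookup φ u)))

  -- Validity is required only off `N x`, which makes the first factor independent of the values on
  -- `N x`. The loss from dropping these vertices is repaid through `chain`.
  spoil : (Fin R → Bool) → Fin L → Vec A R → ℕ
  spoil S x φ = χ (S ∖ N x) φ * 𝟙 (bad (select (N x) φ))

  -- If `v` repeats no value taken on `S` and no neighbour of `v` has a bad image, validity
  -- survives: a vertex `x` not adjacent to `v` with `N x` inside `insert v S` already had `N x`
  -- inside `S`.
  union-bound : ∀ S v φ →
                χ S φ ≤ χ (insert v S) φ + (∑ (allFin R) (λ u → clash S v u φ) + ∑ (allFin L) (λ x → 𝟙 (N x v) * spoil S x φ))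
  union-bound S v φ
    with Finₚ.any? (λ u → (S u Boolₚ.≟ true) ×-dec (lookup φ v ≟ lookup φ u))
       | Finₚ.any? (λ x → (N x v Boolₚ.≟ true) ×-dec (bad (select (N x) φ) Boolₚ.≟ true))
  ... | yes (u , u∈S , φv≡φu) | _ = begin
    χ S φ                  ≡⟨ sym (trans (cong₂ (λ b c → χ S φ * (𝟙 b * 𝟙 c)) u∈S (dec-true (lookup φ v ≟ lookup φ u) φv≡φu)) (*-identityʳ _)) ⟩
    clash S v u φ          ≤⟨ ∑-member (λ u → clash S v u φ) (∈-allFin u) ⟩
    ∑ (allFin R) (λ u → clash S v u φ) ≤⟨ m≤m+n _ _ ⟩
    _                      ≤⟨ m≤n+m _ (χ (insert v S) φ) ⟩
    _                      ∎
    where open ≤-Reasoning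
  ... | no _ | yes (x , v∈Nx , isBad) = begin
    χ S φ                        ≤⟨ χ-anti φ (∖-⊆ S (N x)) ⟩
    χ (S ∖ N x) φ                ≡⟨ sym (trans (cong₂ (λ b c → 𝟙 b * (χ (S ∖ N x) φ * 𝟙 c)) v∈Nx isBad) (trans (*-identityˡ _) (*-identityʳ _))) ⟩
    𝟙 (N x v) * spoil S x φ      ≤⟨ ∑-member (λ x → 𝟙 (N x v) * spoil S x φ) (∈-allFin x) ⟩
    ∑ (allFin L) (λ x → 𝟙 (N x v) * spoil S x φ) ≤⟨ m≤n+m _ (∑ (allFin R) (λ u → clash S v u φ)) ⟩
    _                            ≤⟨ m≤n+m _ (χ (insert v S) φ) ⟩
    _                            ∎
    where open ≤-Reasoning
  ... | no ¬clash | no ¬spoil = ≤-trans (𝟙-mono (valid? S φ) (valid? (insert v S) φ) extend) (m≤m+n _ _)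
    where
    extend : Valid S φ → Valid (insert v S) φ
    extend (inj , good) = inj′ , good′
      where
      inj′ : ∀ u u′ → insert v S u ≡ true → insert v S u′ ≡ true → lookup φ u ≡ lookup φ u′ → u ≡ u′
      inj′ u u′ u∈ u′∈ eq with ∈-insert⁻ v S u u∈ | ∈-insert⁻ v S u′ u′∈
      ... | inj₁ refl | inj₁ refl = refl
      ... | inj₁ refl | inj₂ u′∈S = contradiction (u′ , u′∈S , eq) ¬clash
      ... | inj₂ u∈S  | inj₁ refl = contradiction (u , u∈S , sym eq) ¬clash
      ... | inj₂ u∈S  | inj₂ u′∈S = inj u u′ u∈S u′∈S eq
      good′ : ∀ x → N x ⊆ insert v S → bad (select (N x) φ) ≡ false
      good′ x Nx⊆ with N x v in v∈?Nx
      ... | true  = Boolₚ.¬-not (λ isBad → ¬spoil (x , v∈?Nx , isBad))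
      ... | false = good x Nx⊆S
        where
        Nx⊆S : N x ⊆ S
        Nx⊆S u u∈Nx with ∈-insert⁻ v S u (Nx⊆ u u∈Nx)
        ... | inj₁ refl = contradiction (trans (sym u∈Nx) v∈?Nx) λ ()
        ... | inj₂ u∈S  = u∈S

  -- The missing vertices are inserted one at a time, each at a factor 2. The doubling property is a
  -- hypothesis restricted to sets smaller than `S`, so the lemma can be used within the induction
  -- that proves it.
  chain : ∀ m {S₀ S} → S₀ ⊆ S → count R S ≤ m + count R S₀ →
          (∀ T → count R T < count R S → ∀ v → V T ≤ 2 * V (insert v T)) → V S₀ ≤ 2 ^ m * V S
  chain m {S₀} {S} S₀⊆S |S|≤ doubling with Finₚ.any? (λ v → (S v Boolₚ.≟ true) ×-dec (S₀ v Boolₚ.≟ false))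
  chain m {S₀} {S} S₀⊆S |S|≤ doubling | no none =
    ≤-trans (V-anti S⊆S₀) (m≤n*m (V S) (2 ^ m) {{m^n≢0 2 m}})
    where
    S⊆S₀ : S ⊆ S₀
    S⊆S₀ u u∈S = Boolₚ.¬-not (λ u∉S₀ → none (u , u∈S , u∉S₀))
  chain zero    {S₀} {S} S₀⊆S |S|≤ doubling | yes (v , v∈S , v∉S₀) =
    contradiction |S|≤ (<⇒≱ (count-mono-< R S₀⊆S v v∉S₀ v∈S))
  chain (suc m) {S₀} {S} S₀⊆S |S|≤ doubling | yes (v , v∈S , v∉S₀) = begin
    V S₀                        ≤⟨ doubling S₀ (count-mono-< R S₀⊆S v v∉S₀ v∈S) v ⟩
    2 * V (insert v S₀)         ≤⟨ *-monoʳ-≤ 2 (chain m insert⊆S |S|≤′ doubling) ⟩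
    2 * (2 ^ m * V S)           ≡⟨ sym (*-assoc 2 (2 ^ m) _) ⟩
    2 ^ suc m * V S             ∎
    where
    open ≤-Reasoning
    insert⊆S : insert v S₀ ⊆ S
    insert⊆S u u∈ with ∈-insert⁻ v S₀ u u∈
    ... | inj₁ refl  = v∈S
    ... | inj₂ u∈S₀ = S₀⊆S u u∈S₀
    |S|≤′ : count R S ≤ m + count R (insert v S₀)
    |S|≤′ = begin
      count R S                    ≤⟨ |S|≤ ⟩
      suc (m + count R S₀)         ≡⟨ sym (+-suc m _) ⟩
      m + suc (count R S₀)         ≤⟨ +-monoʳ-≤ m (count-mono-< R (insert-⊇ v S₀) v v∉S₀ (insert-self v S₀)) ⟩
      m + count R (insert v S₀)    ∎

  -- If `R` is 0 then `U` may be empty, but the power is 1; otherwise `large` forces `W` to be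
  -- positive.
  W^R≢0 : NonZero (W ^ R)
  W^R≢0 = >-nonZero (positive R large)
    where
    positive : ∀ r → 4 * r ≤ W → 0 < W ^ r
    positive zero    _ = z<s
    positive (suc r) h = m^n>0 W {{>-nonZero (<-≤-trans z<s h)}} (suc r)

  -- Resample `v` alone. As `v` lies outside `S`, validity on `S` and the value at any `u` in `S`
  -- are unchanged, and the new value at `v` hits that value with probability at most `1 / W`
  -- because `U` has no repetitions.
  clash-bound : ∀ S v u → S v ≡ false → W * ∑ Ω (clash S v u) ≤ V S
  clash-bound S v u v∉S = *-cancelˡ-≤ (W ^ R) {{W^R≢0}} (begin
    W ^ R * (W * ∑ Ω (clash S v u))                                    ≡⟨ *-exchange (W ^ R) W _ ⟩
    W * (W ^ R * ∑ Ω (clash S v u))                                    ≡⟨ cong (W *_) (sym (∑-merge R U e (clash S v u))) ⟩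
    W * ∑ Ω (λ φ → ∑ Ω (λ ψ → clash S v u (merge e φ ψ)))              ≤⟨ *-monoʳ-≤ W (∑-mono Ω (λ φ → ∑-mono Ω (λ ψ → resampled φ ψ))) ⟩
    W * ∑ Ω (λ φ → ∑ Ω (λ ψ → χ S φ * same (lookup φ u) (lookup ψ v))) ≡⟨ cong (W *_) (∑-cong Ω (λ φ → ∑-*ˡ Ω (χ S φ) _)) ⟩
    W * ∑ Ω (λ φ → χ S φ * ∑ Ω (λ ψ → same (lookup φ u) (lookup ψ v))) ≡⟨ sym (∑-*ˡ Ω W _) ⟩
    ∑ Ω (λ φ → W * (χ S φ * ∑ Ω (λ ψ → same (lookup φ u) (lookup ψ v)))) ≡⟨ ∑-cong Ω (λ φ → trans (*-exchange W (χ S φ) _) (cong (χ S φ *_) (∑-tuples-lookup R U v (same (lookup φ u))))) ⟩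
    ∑ Ω (λ φ → χ S φ * (W ^ R * ∑ U (same (lookup φ u))))              ≤⟨ ∑-mono Ω (λ φ → *-monoʳ-≤ (χ S φ) (*-monoʳ-≤ (W ^ R) (U-simple (lookup φ u)))) ⟩
    ∑ Ω (λ φ → χ S φ * (W ^ R * 1))                                    ≡⟨ ∑-*ʳ Ω _ (χ S) ⟩
    V S * (W ^ R * 1)                                                  ≡⟨ trans (cong (V S *_) (*-identityʳ (W ^ R))) (*-comm (V S) _) ⟩
    W ^ R * V S                                                        ∎)
    where
    open ≤-Reasoning
    e : Fin R → Bool
    e w = does (w Finₚ.≟ v)
    same : A → A → ℕ
    same b a = 𝟙 (does (a ≟ b))
    ∈S⇒∉e : ∀ w → S w ≡ true → e w ≡ false
    ∈S⇒∉e w w∈S with w Finₚ.≟ v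
    ... | yes refl = contradiction (trans (sym w∈S) v∉S) λ ()
    ... | no  _    = refl
    resampled : ∀ φ ψ → clash S v u (merge e φ ψ) ≤ χ S φ * same (lookup φ u) (lookup ψ v)
    resampled φ ψ = *-mono-≤ (χ-local (merge e φ ψ) φ (λ w w∈S → lookup-merge-∉ e φ ψ (∈S⇒∉e w w∈S))) collide
      where
      collide : 𝟙 (S u) * 𝟙 (does (lookup (merge e φ ψ) v ≟ lookup (merge e φ ψ) u)) ≤ same (lookup φ u) (lookup ψ v)
      collide with S u in u∈?S
      ... | false = z≤n
      ... | true  = ≤-trans (≤-reflexive (+-identityʳ _)) (𝟙-mono (_ ≟ _) (_ ≟ _) λ eq →
        trans (sym (lookup-merge-∈ e φ ψ (dec-true (v Finₚ.≟ v) refl))) (trans eq (lookup-merge-∉ e φ ψ (∈S⇒∉e u u∈?S))))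

  -- Resample all of `N x`. The validity factor does not see this, and `∑-select` bounds the chance
  -- of a bad fresh image by `X / W ^ k`.
  spoil-bound : ∀ S x → W ^ k * ∑ Ω (spoil S x) ≤ V (S ∖ N x) * X
  spoil-bound S x = *-cancelˡ-≤ (W ^ R) {{W^R≢0}} (begin
    W ^ R * (W ^ k * ∑ Ω (spoil S x))                                  ≡⟨ *-exchange (W ^ R) (W ^ k) _ ⟩
    W ^ k * (W ^ R * ∑ Ω (spoil S x))                                  ≡⟨ cong (W ^ k *_) (sym (∑-merge R U e (spoil S x))) ⟩
    W ^ k * ∑ Ω (λ φ → ∑ Ω (λ ψ → spoil S x (merge e φ ψ)))            ≤⟨ *-monoʳ-≤ (W ^ k) (∑-mono Ω (λ φ → ∑-mono Ω (λ ψ → resampled φ ψ))) ⟩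
    W ^ k * ∑ Ω (λ φ → ∑ Ω (λ ψ → χ S′ φ * B ψ))                       ≡⟨ cong (W ^ k *_) (∑-cong Ω (λ φ → ∑-*ˡ Ω (χ S′ φ) B)) ⟩
    W ^ k * ∑ Ω (λ φ → χ S′ φ * ∑ Ω B)                                 ≡⟨ cong (W ^ k *_) (∑-*ʳ Ω (∑ Ω B) (χ S′)) ⟩
    W ^ k * (V S′ * ∑ Ω B)                                             ≡⟨ *-exchange (W ^ k) (V S′) _ ⟩
    V S′ * (W ^ k * ∑ Ω B)                                             ≤⟨ *-monoʳ-≤ (V S′) (∑-select R U e k (𝟙 ∘ bad) bad-++ (degL x)) ⟩
    V S′ * (W ^ R * X)                                                 ≡⟨ *-exchange (V S′) (W ^ R) X ⟩
    W ^ R * (V S′ * X)                                                 ∎)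
    where
    open ≤-Reasoning
    e = N x
    S′ = S ∖ e
    B : Vec A R → ℕ
    B ψ = 𝟙 (bad (select e ψ))
    resampled : ∀ φ ψ → spoil S x (merge e φ ψ) ≤ χ S′ φ * B ψ
    resampled φ ψ = *-mono-≤ (χ-local (merge e φ ψ) φ (λ w w∈S′ → lookup-merge-∉ e φ ψ (∈-∖⇒∉ S e w w∈S′)))
                             (≤-reflexive (cong (𝟙 ∘ bad) (select-cong e (merge e φ ψ) ψ (λ w w∈e → lookup-merge-∈ e φ ψ w∈e))))

  -- Rosenfeld's counting form of the local lemma.
  doubling : ∀ s S → count R S < s → ∀ v → V S ≤ 2 * V (insert v S)
  -- The bound `s` makes the induction on the size of `S` structural.
  doubling (suc s) S |S|<1+s v with S v in v∈?S
  ... | true  = ≤-trans (V-anti insert⊆S) (m≤m+n _ _)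
    where
    insert⊆S : insert v S ⊆ S
    insert⊆S u u∈ with ∈-insert⁻ v S u u∈
    ... | inj₁ refl = v∈?S
    ... | inj₂ u∈S  = u∈S
  -- Clashes `C` and spoiled maps `D` are each at most a quarter of `V S`, so at least half of `V S`
  -- survives in `V⁺`.
  ... | false = *-cancelˡ-≤ 2 (+-cancelʳ-≤ (2 * V S) _ _ (begin
    2 * V S + 2 * V S             ≡⟨ four (V S) ⟩
    4 * V S                       ≤⟨ *-monoʳ-≤ 4 split ⟩
    4 * (V⁺ + (C + D))            ≡⟨ distribute V⁺ C D ⟩
    2 * (2 * V⁺) + (4 * C + 4 * D) ≤⟨ +-monoʳ-≤ (2 * (2 * V⁺)) (+-mono-≤ 4C≤V 4D≤V) ⟩
    2 * (2 * V⁺) + (V S + V S)    ≡⟨ cong (2 * (2 * V⁺) +_) (cong (V S +_) (sym (+-identityʳ (V S)))) ⟩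
    2 * (2 * V⁺) + 2 * V S        ∎))
    where
    open ≤-Reasoning
    V⁺ = V (insert v S)
    C  = ∑ (allFin R) (λ u → ∑ Ω (clash S v u))
    D  = ∑ (allFin L) (λ x → 𝟙 (N x v) * ∑ Ω (spoil S x))
    four : ∀ a → 2 * a + 2 * a ≡ 4 * a
    four = solve-∀
    distribute : ∀ a c d → 4 * (a + (c + d)) ≡ 2 * (2 * a) + (4 * c + 4 * d)
    distribute = solve-∀
    -- The vertex `v` witnesses that `R` is positive, so `large` applies with content.
    0<W : 0 < W
    0<W = <-≤-trans z<s (≤-trans (*-monoʳ-≤ 4 (0<n v)) large)
      where
      0<n : ∀ {n} → Fin n → 0 < n
      0<n zero    = z<s
      0<n (suc _) = z<s
    instance
      W≢0 : NonZero W
      W≢0 = >-nonZero 0<W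
    split : V S ≤ V⁺ + (C + D)
    split = begin
      V S                                                 ≤⟨ ∑-mono Ω (union-bound S v) ⟩
      _                                                   ≡⟨ ∑-+ Ω _ _ ⟩
      V⁺ + ∑ Ω (λ φ → ∑ (allFin R) (λ u → clash S v u φ) + ∑ (allFin L) (λ x → 𝟙 (N x v) * spoil S x φ)) ≡⟨ cong (V⁺ +_) (∑-+ Ω _ _) ⟩
      V⁺ + (∑ Ω (λ φ → ∑ (allFin R) (λ u → clash S v u φ)) + ∑ Ω (λ φ → ∑ (allFin L) (λ x → 𝟙 (N x v) * spoil S x φ)))
        ≡⟨ cong₂ (λ c d → V⁺ + (c + d)) (∑-swap Ω (allFin R) _) (trans (∑-swap Ω (allFin L) _) (∑-cong (allFin L) (λ x → ∑-*ˡ Ω (𝟙 (N x v)) _))) ⟩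
      V⁺ + (C + D)                                        ∎
    4C≤V : 4 * C ≤ V S
    4C≤V = *-cancelˡ-≤ W (begin
      W * (4 * C)                                          ≡⟨ *-exchange W 4 C ⟩
      4 * (W * C)                                          ≡⟨ cong (4 *_) (sym (∑-*ˡ (allFin R) W _)) ⟩
      4 * ∑ (allFin R) (λ u → W * ∑ Ω (clash S v u))       ≤⟨ *-monoʳ-≤ 4 (∑-mono (allFin R) (λ u → clash-bound S v u v∈?S)) ⟩
      4 * ∑ (allFin R) (λ _ → V S)                         ≡⟨ cong (4 *_) (trans (∑-const (allFin R) (V S)) (cong (_* V S) (length-tabulate {n = R} id))) ⟩
      4 * (R * V S)                                        ≡⟨ sym (*-assoc 4 R (V S)) ⟩
      4 * R * V S                                          ≤⟨ *-monoˡ-≤ (V S) large ⟩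
      W * V S                                              ∎)
    -- At most `k` vertices were removed from `S`, and every set that `chain` enlarges on the way
    -- back is smaller than `S`, within reach of the induction hypothesis.
    smaller : ∀ x → V (S ∖ N x) ≤ 2 ^ k * V S
    smaller x = chain k (∖-⊆ S (N x)) (≤-trans (count-∖ R S (N x)) (+-monoˡ-≤ _ (degL x)))
                      (λ T |T|<|S| → doubling s T (<-≤-trans |T|<|S| (s≤s⁻¹ |S|<1+s)))
    4D≤V : 4 * D ≤ V S
    -- At most `Δ` vertices are adjacent to `v`, each spoiling at most `2 ^ k * X / W ^ k` times
    -- `V S` maps; `4 * 2 ^ k ≤ 8 ^ k` then brings in `rare`.
    4D≤V = *-cancelˡ-≤ (W ^ k) {{m^n≢0 W k}} (begin
      W ^ k * (4 * D)                                                       ≡⟨ *-exchange (W ^ k) 4 D ⟩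
      4 * (W ^ k * D)                                                       ≡⟨ cong (4 *_) (sym (∑-*ˡ (allFin L) (W ^ k) _)) ⟩
      4 * ∑ (allFin L) (λ x → W ^ k * (𝟙 (N x v) * ∑ Ω (spoil S x)))        ≤⟨ *-monoʳ-≤ 4 (∑-mono (allFin L) term) ⟩
      4 * ∑ (allFin L) (λ x → 𝟙 (N x v) * (2 ^ k * V S * X))                ≡⟨ cong (4 *_) (∑-*ʳ (allFin L) _ (λ x → 𝟙 (N x v))) ⟩
      4 * (∑ (allFin L) (λ x → 𝟙 (N x v)) * (2 ^ k * V S * X))              ≤⟨ *-monoʳ-≤ 4 (*-monoˡ-≤ _ (≤-trans (≤-reflexive (sym (count≡∑ L (λ x → N x v)))) (degR v))) ⟩
      4 * (Δ * (2 ^ k * V S * X))                                           ≡⟨ regroup Δ (2 ^ k) (V S) X ⟩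
      (4 * 2 ^ k) * (Δ * X) * V S                                           ≤⟨ *-monoˡ-≤ (V S) (≤-trans (*-monoˡ-≤ (Δ * X) (4*2ᵏ≤8ᵏ k 1≤k)) rare) ⟩
      W ^ k * V S                                                           ∎)
      where
      regroup : ∀ Δ p v x → 4 * (Δ * (p * v * x)) ≡ (4 * p) * (Δ * x) * v
      regroup = solve-∀
      term : ∀ x → W ^ k * (𝟙 (N x v) * ∑ Ω (spoil S x)) ≤ 𝟙 (N x v) * (2 ^ k * V S * X)
      term x = begin
        W ^ k * (𝟙 (N x v) * ∑ Ω (spoil S x))   ≡⟨ *-exchange (W ^ k) (𝟙 (N x v)) _ ⟩
        𝟙 (N x v) * (W ^ k * ∑ Ω (spoil S x))   ≤⟨ *-monoʳ-≤ (𝟙 (N x v)) (≤-trans (spoil-bound S x) (*-monoˡ-≤ X (smaller x))) ⟩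
        𝟙 (N x v) * (2 ^ k * V S * X)           ∎

  -- Every map is valid on the empty set, and going from there to the full set by `chain` loses only
  -- a power of 2.
  valid-exists : ∃ (Valid (λ _ → true))
  valid-exists with ∑-positive Ω (χ (λ _ → true)) (pos {2 ^ count R (λ _ → true)} V-full)
    where
    full empty : Fin R → Bool
    full  _ = true
    empty _ = false
    pos : ∀ {m n} → 0 < m * n → 0 < n
    pos {m} {zero}  h = contradiction (subst (0 <_) (*-zeroʳ m) h) λ ()
    pos {m} {suc n} h = z<s
    Valid-empty : ∀ φ → Valid empty φ
    -- Left vertices without neighbours are constrained even here; `bad-[]` settles them.
    Valid-empty φ = (λ _ _ ()) , (λ x Nx⊆∅ → trans (cong bad (select-∅ (N x) φ (λ u → Boolₚ.¬-not (λ u∈Nx → contradiction (Nx⊆∅ u u∈Nx) λ ())))) bad-[])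
    V-empty : V empty ≡ W ^ R * 1
    V-empty = trans (∑-cong Ω (λ φ → cong 𝟙 (dec-true (valid? empty φ) (Valid-empty φ)))) (∑-tuples-const R U 1)
    V-full : 0 < 2 ^ count R full * V full
    V-full = ≤-trans (≤-trans (>-nonZero⁻¹ (W ^ R) {{W^R≢0}}) (≤-reflexive (sym (trans V-empty (*-identityʳ _)))))
                     (chain (count R full) (λ _ _ → refl) (m≤m+n _ _) (λ T |T|< → doubling (count R full) T |T|<))
  ... | φ , 0<χ = φ , 𝟙-positive (valid? _ φ) 0<χ

-- Powers, universal quantification over lists, and greedy choice.

does-false⇒¬ : ∀ {P : Set} (p : Dec P) → does p ≡ false → ¬ P
does-false⇒¬ (no ¬p) _ = ¬p

^-distribʳ-* : ∀ m n k → (m * n) ^ k ≡ m ^ k * n ^ k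
^-distribʳ-* m n zero    = refl
^-distribʳ-* m n (suc k) = trans (cong (m * n *_) (^-distribʳ-* m n k)) (*-interchange m n (m ^ k) (n ^ k))

^-cancelˡ-≤ : ∀ k .{{_ : NonZero k}} {m n} → m ^ k ≤ n ^ k → m ≤ n
^-cancelˡ-≤ k mᵏ≤nᵏ = ≮⇒≥ (λ n<m → ≤⇒≯ mᵏ≤nᵏ (^-monoˡ-< k n<m))

module _ {I : Set} where

  all-++ˡ : ∀ (p : I → Bool) l l′ → all p (l ++ l′) ≡ true → all p l ≡ true
  all-++ˡ p []      l′ h = refl
  all-++ˡ p (x ∷ l) l′ h with p x
  ... | true = all-++ˡ p l l′ h

  all-true : ∀ (l : List I) → all (λ _ → true) l ≡ true
  all-true []      = refl
  all-true (x ∷ l) = all-true l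

  all-∧ : ∀ (p q : I → Bool) l → all (λ i → p i ∧ q i) l ≡ all p l ∧ all q l
  all-∧ p q []      = refl
  all-∧ p q (x ∷ l) with p x | q x
  ... | true  | true  = all-∧ p q l
  ... | true  | false = sym (Boolₚ.∧-zeroʳ (all p l))
  ... | false | _     = refl

-- For adjacency `r`: a tuple `xs` lies in the common neighbourhood of `ys` exactly when `ys` lies
-- in that of `xs`.
all-swap : ∀ {I J : Set} (r : I → J → Bool) xs ys →
           all (λ x → all (r x) ys) xs ≡ all (λ y → all (λ x → r x y) xs) ys
all-swap r []       ys = sym (all-true ys)
all-swap r (x ∷ xs) ys = trans (cong (all (r x) ys ∧_) (all-swap r xs ys)) (sym (all-∧ (r x) _ ys))

all-select⁻ : ∀ {A : Set} {r} (e : Fin r → Bool) (φ : Vec A r) p →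
              all p (select e φ) ≡ true → ∀ v → e v ≡ true → p (lookup φ v) ≡ true
all-select⁻ e (a ∷ φ) p h v v∈e with e zero in 0∈?e | v
... | true  | zero  = Boolₚ.∧-conicalˡ _ _ h
... | true  | suc v = all-select⁻ (e ∘ suc) φ p (Boolₚ.∧-conicalʳ (p a) _ h) v v∈e
... | false | zero  = contradiction (trans (sym v∈e) 0∈?e) λ ()
... | false | suc v = all-select⁻ (e ∘ suc) φ p h v v∈e

count≤n : ∀ n p → count n p ≤ n
count≤n zero    p = z≤n
count≤n (suc n) p with p zero
... | true  = s≤s (count≤n n (p ∘ suc))
... | false = m≤n⇒m≤1+n (count≤n n (p ∘ suc))

count-true : ∀ n → count n (λ _ → true) ≡ n
count-true zero    = refl
count-true (suc n) = cong suc (count-true n)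

count-false : ∀ n → count n (λ _ → false) ≡ 0
count-false zero    = refl
count-false (suc n) = count-false n

count-singleton : ∀ n v → count n (λ u → does (u Finₚ.≟ v)) ≡ 1
count-singleton (suc n) zero    = cong suc (count-false n)
count-singleton (suc n) (suc v) = count-singleton n v

count-positive : ∀ n p → 0 < count n p → ∃ λ i → p i ≡ true
count-positive (suc n) p 0<c with p zero in p0
... | true  = zero , p0
... | false with count-positive n (p ∘ suc) 0<c
...   | i , pi = suc i , pi

-- Greedy: the first index takes any candidate `y`, and deleting `y` costs each remaining set at
-- most one element, which the decrease of `m` allows.
distinct-representatives : ∀ m b (C : Fin m → Fin b → Bool) → (∀ x → m ≤ count b (C x)) →
  ∃ λ (f : Fin m → Fin b) → (∀ x x′ → f x ≡ f x′ → x ≡ x′) × (∀ x → C x (f x) ≡ true)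
distinct-representatives zero    b C large = (λ ()) , (λ ()) , (λ ())
distinct-representatives (suc m) b C large
  with count-positive b (C zero) (<-≤-trans z<s (large zero))
... | y , y∈C₀ with distinct-representatives m b C′ large′
  where
  is-y : Fin b → Bool
  is-y w = does (w Finₚ.≟ y)
  C′ : Fin m → Fin b → Bool
  C′ x = C (suc x) ∖ is-y
  large′ : ∀ x → m ≤ count b (C′ x)
  large′ x = s≤s⁻¹ (≤-trans (large (suc x)) (≤-trans (count-∖ b (C (suc x)) is-y) (≤-reflexive (cong (_+ count b (C′ x)) (count-singleton b y)))))
... | f , f-inj , f∈C′ = f⁺ , f⁺-inj , f⁺∈C
  where
  f⁺ : Fin (suc m) → Fin b
  f⁺ zero    = y
  f⁺ (suc x) = f x
  f≢y : ∀ x → f x ≢ y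
  f≢y x fx≡y = contradiction (trans (sym (dec-true (f x Finₚ.≟ y) fx≡y)) (∈-∖⇒∉ (C (suc x)) (λ w → does (w Finₚ.≟ y)) (f x) (f∈C′ x))) λ ()
  f⁺-inj : ∀ x x′ → f⁺ x ≡ f⁺ x′ → x ≡ x′
  f⁺-inj zero    zero     eq = refl
  f⁺-inj zero    (suc x′) eq = contradiction (sym eq) (f≢y x′)
  f⁺-inj (suc x) zero     eq = contradiction eq (f≢y x)
  f⁺-inj (suc x) (suc x′) eq = cong suc (f-inj x x′ eq)
  f⁺∈C : ∀ x → C x (f⁺ x) ≡ true
  f⁺∈C zero    = y∈C₀
  f⁺∈C (suc x) = ∖-⊆ (C (suc x)) (λ w → does (w Finₚ.≟ y)) (f x) (f∈C′ x)

-- Dependent random choice in the host graph.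

module Host {a b : ℕ} (g : Fin a → Fin b → Bool) (n : ℕ) where

  codegree : List (Fin a) → ℕ
  codegree l = count b (λ t → all (λ i → g i t) l)

  poor : List (Fin a) → Bool
  poor l = does (codegree l <? n)

  poor-++ : ∀ l l′ → 𝟙 (poor l) ≤ 𝟙 (poor (l ++ l′))
  poor-++ l l′ = 𝟙-mono (_ <? n) (_ <? n) (≤-<-trans (count-mono b (λ t → all-++ˡ (λ i → g i t) l l′)))

  common : ∀ {k} → Vec (Fin b) k → List (Fin a)
  common T = filterᵇ (λ i → all (g i) (toList T)) (allFin a)

  poorTuples : ∀ {k} → Vec (Fin b) k → ℕ
  poorTuples {k} T = ∑ (tuples k (common T)) (𝟙 ∘ poor ∘ toList)

  edges : ℕ
  edges = ∑ (allFin a) (λ i → count b (g i))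

  length-allFin : ∀ n → length (allFin n) ≡ n
  length-allFin n = length-tabulate id

  edges≤ : edges ≤ a * b
  edges≤ = begin
    edges                     ≤⟨ ∑-mono (allFin a) (λ i → count≤n b (g i)) ⟩
    ∑ (allFin a) (λ _ → b)    ≡⟨ ∑-const (allFin a) b ⟩
    length (allFin a) * b     ≡⟨ cong (_* b) (length-allFin a) ⟩
    a * b                     ∎
    where open ≤-Reasoning

  -- Double counting of pairs of `i` and `T`: the entries of `T` are independent choices among the
  -- neighbours of `i`.
  ∑-common : ∀ k → ∑ (tuples k (allFin b)) (length ∘ common) ≡ ∑ (allFin a) (λ i → count b (g i) ^ k)
  ∑-common k = begin
    ∑ (tuples k (allFin b)) (length ∘ common)                                          ≡⟨ ∑-cong (tuples k (allFin b)) (λ T → length-filter (allFin a) _) ⟩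
    ∑ (tuples k (allFin b)) (λ T → ∑ (allFin a) (λ i → 𝟙 (all (g i) (toList T))))      ≡⟨ ∑-swap (tuples k (allFin b)) (allFin a) _ ⟩
    ∑ (allFin a) (λ i → ∑ (tuples k (allFin b)) (λ T → 𝟙 (all (g i) (toList T))))      ≡⟨ ∑-cong (allFin a) (λ i → trans (∑-tuples-all k (allFin b) (g i)) (cong (_^ k) (sym (count≡∑ b (g i))))) ⟩
    ∑ (allFin a) (λ i → count b (g i) ^ k)                                             ∎
    where open ≡-Reasoning

  -- A poor k-tuple lies in the common neighbourhood of fewer than n ^ k of the tuples T.
  ∑-poorTuples : ∀ k → ∑ (tuples k (allFin b)) poorTuples ≤ a ^ k * n ^ k
  ∑-poorTuples k = begin
    ∑ Tₖ poorTuples                                                                    ≡⟨ ∑-cong Tₖ (λ T → ∑-tuples-filter k (allFin a) _ _) ⟩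
    ∑ Tₖ (λ T → ∑ Sₖ (λ S → 𝟙 (all (λ i → all (g i) (toList T)) (toList S)) * 𝟙 (poor (toList S))))  ≡⟨ ∑-swap Tₖ Sₖ _ ⟩
    ∑ Sₖ (λ S → ∑ Tₖ (λ T → 𝟙 (all (λ i → all (g i) (toList T)) (toList S)) * 𝟙 (poor (toList S))))  ≡⟨ ∑-cong Sₖ (λ S → ∑-*ʳ Tₖ (𝟙 (poor (toList S))) _) ⟩
    ∑ Sₖ (λ S → ∑ Tₖ (λ T → 𝟙 (all (λ i → all (g i) (toList T)) (toList S))) * 𝟙 (poor (toList S)))  ≡⟨ ∑-cong Sₖ (λ S → cong (_* 𝟙 (poor (toList S))) (codegree-power S)) ⟩
    ∑ Sₖ (λ S → codegree (toList S) ^ k * 𝟙 (poor (toList S)))                         ≤⟨ ∑-mono Sₖ (λ S → poor-power (toList S)) ⟩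
    ∑ Sₖ (λ S → n ^ k)                                                                 ≡⟨ ∑-tuples-const k (allFin a) (n ^ k) ⟩
    length (allFin a) ^ k * n ^ k                                                      ≡⟨ cong (λ m → m ^ k * n ^ k) (length-allFin a) ⟩
    a ^ k * n ^ k                                                                      ∎
    where
    open ≤-Reasoning
    Tₖ = tuples k (allFin b)
    Sₖ = tuples k (allFin a)
    codegree-power : ∀ (S : Vec (Fin a) k) → ∑ Tₖ (λ T → 𝟙 (all (λ i → all (g i) (toList T)) (toList S))) ≡ codegree (toList S) ^ k
    codegree-power S = trans (∑-cong Tₖ (λ T → cong 𝟙 (all-swap g (toList S) (toList T))))
                      (trans (∑-tuples-all k (allFin b) _) (cong (_^ k) (sym (count≡∑ b _))))
    poor-power : ∀ l → codegree l ^ k * 𝟙 (poor l) ≤ n ^ k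
    poor-power l = bounded (codegree l <? n)
      where
      bounded : (p : Dec (codegree l < n)) → codegree l ^ k * 𝟙 (does p) ≤ n ^ k
      bounded (yes c<n) = ≤-trans (≤-reflexive (*-identityʳ _)) (^-monoˡ-≤ k (<⇒≤ c<n))
      bounded (no  _)   = ≤-trans (≤-reflexive (*-zeroʳ (codegree l ^ k))) z≤n

  -- Bounding `edges` by `a * b` lets the density factor cancel. The conclusion ensures that the
  -- empty list is not poor.
  order≤ : ∀ k c → 1 ≤ k → 1 ≤ c → 1 ≤ edges →
           c * n ^ k * (a * b) ^ (k * k) ≤ b ^ k * edges ^ (k * k) → n ≤ b
  order≤ k c 1≤k 1≤c 1≤E bLarge = ^-cancelˡ-≤ k {{>-nonZero 1≤k}} (*-cancelʳ-≤ (n ^ k) (b ^ k) M (begin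
    n ^ k * M                     ≤⟨ *-monoˡ-≤ M (m≤n*m (n ^ k) c {{>-nonZero 1≤c}}) ⟩
    c * n ^ k * M                 ≤⟨ bLarge ⟩
    b ^ k * edges ^ (k * k)       ≤⟨ *-monoʳ-≤ (b ^ k) (^-monoˡ-≤ (k * k) edges≤) ⟩
    b ^ k * M                     ∎))
    where
    open ≤-Reasoning
    M = (a * b) ^ (k * k)
    instance
      M≢0 : NonZero M
      M≢0 = m^n≢0 (a * b) (k * k) {{>-nonZero (≤-trans 1≤E edges≤)}}

  -- `j` is the exponent `k - 1` produced by `power-mean`, and `M` is the denominator of the density
  -- raised to `k * k`. `P` and `Q` are the first and `k`-th moments of the size of the common
  -- neighbourhood.
  module Averaging (j c : ℕ) (1≤E : 1 ≤ edges) where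

    k = suc j
    M = (a * b) ^ (k * k)
    Tₖ = tuples k (allFin b)
    P = ∑ Tₖ (length ∘ common)
    Q = ∑ Tₖ (λ T → length (common T) ^ k)

    instance
      M≢0 : NonZero M
      M≢0 = m^n≢0 (a * b) (k * k) {{>-nonZero (≤-trans 1≤E edges≤)}}

    -- Convexity over the left degrees; `Pᵏ≤` then applies convexity over the choices of `T`.
    Eᵏ≤ : edges ^ k ≤ a ^ j * P
    Eᵏ≤ = ≤-trans (power-mean (allFin a) (λ i → count b (g i)) j)
                  (≤-reflexive (cong₂ (λ m s → m ^ j * s) (length-allFin a) (sym (∑-common k))))

    Pᵏ≤ : P ^ k ≤ (b ^ k) ^ j * Q
    Pᵏ≤ = ≤-trans (power-mean Tₖ (length ∘ common) j)
                  (≤-reflexive (cong (λ m → m ^ j * Q) (trans (length-tuples k (allFin b)) (cong (_^ k) (length-allFin b)))))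

    -- Q counts the homomorphic copies of K(k,k); this is the Sidorenko inequality for K(k,k).
    copies : (a ^ k * b ^ k) * edges ^ (k * k) ≤ M * Q
    copies = begin
      (a ^ k * b ^ k) * edges ^ (k * k)                    ≡⟨ cong ((a ^ k * b ^ k) *_) (sym (^-*-assoc edges k k)) ⟩
      (a ^ k * b ^ k) * (edges ^ k) ^ k                    ≤⟨ *-monoʳ-≤ (a ^ k * b ^ k) (^-monoˡ-≤ k Eᵏ≤) ⟩
      (a ^ k * b ^ k) * (a ^ j * P) ^ k                    ≡⟨ cong ((a ^ k * b ^ k) *_) (^-distribʳ-* (a ^ j) P k) ⟩
      (a ^ k * b ^ k) * ((a ^ j) ^ k * P ^ k)              ≤⟨ *-monoʳ-≤ (a ^ k * b ^ k) (*-monoʳ-≤ ((a ^ j) ^ k) Pᵏ≤) ⟩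
      (a ^ k * b ^ k) * ((a ^ j) ^ k * ((b ^ k) ^ j * Q))  ≡⟨ regroup (a ^ k) (b ^ k) ((a ^ j) ^ k) ((b ^ k) ^ j) Q ⟩
      ((a ^ k * (a ^ j) ^ k) * (b ^ k * (b ^ k) ^ j)) * Q  ≡⟨ cong (_* Q) (cong₂ _*_ powerᵃ (^-*-assoc b k k)) ⟩
      (a ^ (k * k) * b ^ (k * k)) * Q                      ≡⟨ cong (_* Q) (sym (^-distribʳ-* a b (k * k))) ⟩
      M * Q                                                ∎
      where
      open ≤-Reasoning
      regroup : ∀ p q r s t → (p * q) * (r * (s * t)) ≡ ((p * r) * (q * s)) * t
      regroup = solve-∀
      powerᵃ : a ^ k * (a ^ j) ^ k ≡ a ^ (k * k)
      powerᵃ = trans (cong (a ^ k *_) (^-*-assoc a j k)) (sym (^-distribˡ-+-* a k (j * k)))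

    -- Over all `T`, both the poor tuples and the constant `n ^ k` total at most `Q / c`. Averaging
    -- their sum yields a single `T` that controls both: the first part makes poor tuples rare, the
    -- second makes `common T` large.
    choose :
      c * n ^ k * M ≤ a ^ k * edges ^ (k * k) → c * n ^ k * M ≤ b ^ k * edges ^ (k * k) →
      ∃ λ (T : Vec (Fin b) k) → c * (poorTuples T + n ^ k) ≤ 2 * length (common T) ^ k
    choose aLarge bLarge = ∑-average Tₖ _ _ (≤-trans 0<bᵏ (≤-reflexive (sym |Tₖ|))) (begin
      ∑ Tₖ (λ T → c * (poorTuples T + n ^ k))         ≡⟨ ∑-*ˡ Tₖ c _ ⟩
      c * ∑ Tₖ (λ T → poorTuples T + n ^ k)           ≡⟨ cong (c *_) (∑-+ Tₖ poorTuples _) ⟩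
      c * (∑ Tₖ poorTuples + ∑ Tₖ (λ _ → n ^ k))      ≤⟨ *-monoʳ-≤ c (+-mono-≤ (∑-poorTuples k) (≤-reflexive (trans (∑-const Tₖ (n ^ k)) (cong (_* n ^ k) |Tₖ|)))) ⟩
      c * (a ^ k * n ^ k + b ^ k * n ^ k)             ≡⟨ *-distribˡ-+ c _ _ ⟩
      c * (a ^ k * n ^ k) + c * (b ^ k * n ^ k)       ≤⟨ +-mono-≤ (*-cancelˡ-≤ M boundᵃ) (*-cancelˡ-≤ M boundᵇ) ⟩
      Q + Q                                           ≡⟨ cong (Q +_) (sym (+-identityʳ Q)) ⟩
      2 * Q                                           ≡⟨ sym (∑-*ˡ Tₖ 2 _) ⟩
      ∑ Tₖ (λ T → 2 * length (common T) ^ k)          ∎)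
      where
      open ≤-Reasoning
      |Tₖ| : length Tₖ ≡ b ^ k
      |Tₖ| = trans (length-tuples k (allFin b)) (cong (_^ k) (length-allFin b))
      0<bᵏ : 0 < b ^ k
      0<bᵏ = m^n>0 b {{>-nonZero (positive a b (≤-trans 1≤E edges≤))}} k
        where
        positive : ∀ x y → 0 < x * y → 0 < y
        positive x zero    h = contradiction (subst (0 <_) (*-zeroʳ x) h) λ ()
        positive x (suc y) h = z<s
      regroup : ∀ m c p q → m * (c * (p * q)) ≡ p * (c * q * m)
      regroup = solve-∀
      -- Each size hypothesis serves the other part: `a ^ k` is present already, and `bLarge`
      -- supplies the `b ^ k` needed for `copies`.
      boundᵃ : M * (c * (a ^ k * n ^ k)) ≤ M * Q
      boundᵃ = begin
        M * (c * (a ^ k * n ^ k))              ≡⟨ regroup M c (a ^ k) (n ^ k) ⟩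
        a ^ k * (c * n ^ k * M)                ≤⟨ *-monoʳ-≤ (a ^ k) bLarge ⟩
        a ^ k * (b ^ k * edges ^ (k * k))      ≡⟨ sym (*-assoc (a ^ k) (b ^ k) _) ⟩
        (a ^ k * b ^ k) * edges ^ (k * k)      ≤⟨ copies ⟩
        M * Q                                  ∎
      boundᵇ : M * (c * (b ^ k * n ^ k)) ≤ M * Q
      boundᵇ = begin
        M * (c * (b ^ k * n ^ k))              ≡⟨ regroup M c (b ^ k) (n ^ k) ⟩
        b ^ k * (c * n ^ k * M)                ≤⟨ *-monoʳ-≤ (b ^ k) aLarge ⟩
        b ^ k * (a ^ k * edges ^ (k * k))      ≡⟨ trans (*-exchange (b ^ k) (a ^ k) _) (sym (*-assoc (a ^ k) (b ^ k) _)) ⟩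
        (a ^ k * b ^ k) * edges ^ (k * k)      ≤⟨ copies ⟩
        M * Q                                  ∎

  dependent-random-choice : ∀ k c → 1 ≤ k → 1 ≤ edges →
    c * n ^ k * (a * b) ^ (k * k) ≤ a ^ k * edges ^ (k * k) →
    c * n ^ k * (a * b) ^ (k * k) ≤ b ^ k * edges ^ (k * k) →
    ∃ λ (T : Vec (Fin b) k) → c * (poorTuples T + n ^ k) ≤ 2 * length (common T) ^ k
  dependent-random-choice (suc j) c _ 1≤E = Averaging.choose j c 1≤E

-- The constants, and the embedding.

-- Passing from 16 to 8 absorbs the factor 2 left by the averaging, in both `rarity` and `size`.
2*8ᵏ≤16ᵏ : ∀ k → 1 ≤ k → 2 * 8 ^ k ≤ 16 ^ k
2*8ᵏ≤16ᵏ (suc j) _ = ≤-trans (≤-reflexive (sym (*-assoc 2 8 (8 ^ j)))) (*-monoʳ-≤ 16 (^-monoˡ-≤ j (m≤m+n 8 8)))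

rarity : ∀ k Δ X m w → 1 ≤ k → 16 ^ k * Δ * (X + m) ≤ 2 * w → 8 ^ k * (Δ * X) ≤ w
rarity k Δ X m w 1≤k h = *-cancelˡ-≤ 2 (begin
  2 * (8 ^ k * (Δ * X))     ≡⟨ sym (*-assoc 2 (8 ^ k) _) ⟩
  2 * 8 ^ k * (Δ * X)       ≤⟨ *-monoˡ-≤ (Δ * X) (2*8ᵏ≤16ᵏ k 1≤k) ⟩
  16 ^ k * (Δ * X)          ≡⟨ sym (*-assoc (16 ^ k) Δ X) ⟩
  16 ^ k * Δ * X            ≤⟨ *-monoʳ-≤ (16 ^ k * Δ) (m≤m+n X m) ⟩
  16 ^ k * Δ * (X + m)      ≤⟨ h ⟩
  2 * w                     ∎)
  where open ≤-Reasoning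

size : ∀ k Δ X n w → 1 ≤ k → 1 ≤ Δ → 16 ^ k * Δ * (X + n ^ k) ≤ 2 * w ^ k → 8 * n ≤ w
size k Δ X n w 1≤k 1≤Δ h = ^-cancelˡ-≤ k {{>-nonZero 1≤k}} (*-cancelˡ-≤ 2 (begin
  2 * (8 * n) ^ k           ≡⟨ cong (2 *_) (^-distribʳ-* 8 n k) ⟩
  2 * (8 ^ k * n ^ k)       ≡⟨ sym (*-assoc 2 (8 ^ k) _) ⟩
  2 * 8 ^ k * n ^ k         ≤⟨ *-monoˡ-≤ (n ^ k) (≤-trans (2*8ᵏ≤16ᵏ k 1≤k) (m≤m*n (16 ^ k) Δ {{>-nonZero 1≤Δ}})) ⟩
  16 ^ k * Δ * n ^ k        ≤⟨ *-monoʳ-≤ (16 ^ k * Δ) (m≤n+m (n ^ k) X) ⟩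
  16 ^ k * Δ * (X + n ^ k)  ≤⟨ h ⟩
  2 * w ^ k                 ∎))
  where open ≤-Reasoning

module _
  (H G : BipGraph) (k Δ : ℕ) (1≤k : 1 ≤ k)
  (degL : ∀ x → degLeft H x ≤ k) (degR : ∀ y → degRight H y ≤ Δ)
  where

  open Host (adj G) (numVertices H)

  -- The parts are crossed: the right part of `H` enters `common T` in the left part of `G`, and the
  -- left part of `H`, with degrees at most `k`, is placed afterwards in the right part of `G`.
  module Embedding
    (n≤b : numVertices H ≤ right G)
    (T : Vec (Fin (right G)) k)
    (large : 4 * right H ≤ length (common T))
    (rare : 8 ^ k * (Δ * poorTuples T) ≤ length (common T) ^ k)
    where

    n = numVertices H
    U = common T

    U-simple : ∀ i → ∑ U (λ u → 𝟙 (does (u Finₚ.≟ i))) ≤ 1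
    U-simple i = begin
      ∑ U (λ u → 𝟙 (does (u Finₚ.≟ i)))                               ≡⟨ ∑-filter (allFin (left G)) _ _ ⟩
      ∑ (allFin (left G)) (λ u → 𝟙 (all (adj G u) (toList T)) * 𝟙 (does (u Finₚ.≟ i))) ≤⟨ ∑-mono (allFin (left G)) (λ u → 𝟙*m≤m (all (adj G u) (toList T)) _) ⟩
      ∑ (allFin (left G)) (λ u → 𝟙 (does (u Finₚ.≟ i)))               ≡⟨ sym (count≡∑ (left G) _) ⟩
      count (left G) (λ u → does (u Finₚ.≟ i))                        ≡⟨ count-singleton (left G) i ⟩
      1                                                               ∎
      where
      open ≤-Reasoning
      𝟙*m≤m : ∀ b m → 𝟙 b * m ≤ m
      𝟙*m≤m true  m = ≤-reflexive (+-identityʳ m)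
      𝟙*m≤m false m = z≤n

    -- Every right vertex of `G` is a common neighbour of the empty list.
    poor-[] : poor [] ≡ false
    poor-[] = dec-false (codegree [] <? n) (λ b<n → <⇒≱ (subst (_< n) (count-true (right G)) b<n) n≤b)

    open Counting Finₚ._≟_ U U-simple poor poor-[] poor-++ (adj H) k Δ 1≤k degL degR large rare using (valid-exists)

    embed : IsSubgraph H G
    embed with valid-exists
    ... | φ , φ-inj , rich with distinct-representatives (left H) (right G) (λ x t → all (λ i → adj G i t) (select (adj H x) φ)) enough
      where
      enough : ∀ x → left H ≤ codegree (select (adj H x) φ)
      -- Being valid on the full set makes the image of every neighbourhood not poor, leaving at
      -- least `numVertices H` candidates.
      enough x = ≤-trans (m≤m+n (left H) (right H))
                         (≮⇒≥ (does-false⇒¬ (codegree (select (adj H x) φ) <? n) (rich x (λ _ _ → refl))))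
    ...   | f , f-inj , f-common = ι , ι-injective , ι-adj
      where
      ι : Vertex H → Vertex G
      ι (inj₁ x) = inj₂ (f x)
      ι (inj₂ v) = inj₁ (lookup φ v)
      ι-injective : ∀ {u v} → ι u ≡ ι v → u ≡ v
      ι-injective {inj₁ x} {inj₁ x′} eq = cong inj₁ (f-inj x x′ (inj₂-injective eq))
      ι-injective {inj₂ v} {inj₂ v′} eq = cong inj₂ (φ-inj v v′ refl refl (inj₁-injective eq))
      edge : ∀ x v → adj H x v ≡ true → adj G (lookup φ v) (f x) ≡ true
      edge x = all-select⁻ (adj H x) φ (λ i → adj G i (f x)) (f-common x)
      ι-adj : ∀ u v → Adj H u v → Adj G (ι u) (ι v)
      ι-adj (inj₁ x) (inj₂ v) = edge x v
      ι-adj (inj₂ v) (inj₁ x) = edge x v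

-- With density `edgeCount G / (left G * right G)`, the size condition on each part is raised to the
-- power `k` and cleared of denominators, which removes the root of `Δ` and the negative power. A
-- positive edge count keeps the density nonzero.
theorem4p7 : (H G : BipGraph) (k Δ : ℕ) → 1 ≤ k → 1 ≤ Δ
    → (∀ x → degLeft H x ≤ k)
    → (∀ y → degRight H y ≤ Δ)
    → 1 ≤ edgeCount G
    → left G ^ k * edgeCount G ^ (k * k)
    ≥ 16 ^ k * Δ * numVertices H ^ k * (left G * right G) ^ (k * k)
    → right G ^ k * edgeCount G ^ (k * k)
    ≥ 16 ^ k * Δ * numVertices H ^ k * (left G * right G) ^ (k * k)
    → IsSubgraph H G
theorem4p7 H G k Δ 1≤k 1≤Δ degL degR 1≤E aLarge bLarge =
  Embedding.embed H G k Δ 1≤k degL degR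
    (order≤ k c 1≤k 1≤c 1≤E′ (large (right G) bLarge))
    (proj₁ choice)
    -- `size` gives `8 * n`, which dominates the required `4 * right H`.
    (≤-trans (*-mono-≤ (m≤m+n 4 4) (m≤n+m (right H) (left H))) (size k Δ (poorTuples (proj₁ choice)) n (length (common (proj₁ choice))) 1≤k 1≤Δ (proj₂ choice)))
    (rarity k Δ (poorTuples (proj₁ choice)) (n ^ k) (length (common (proj₁ choice)) ^ k) 1≤k (proj₂ choice))
  where
  n = numVertices H
  c = 16 ^ k * Δ
  open Host (adj G) n
  1≤c : 1 ≤ c
  1≤c = >-nonZero⁻¹ c {{m*n≢0 (16 ^ k) Δ {{m^n≢0 16 k}} {{>-nonZero 1≤Δ}}}}
  edgeCount≡ : edgeCount G ≡ edges
  edgeCount≡ = sumFin≡∑ (left G) (degLeft G)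
  1≤E′ : 1 ≤ edges
  1≤E′ = subst (1 ≤_) edgeCount≡ 1≤E
  large : ∀ m → c * n ^ k * (left G * right G) ^ (k * k) ≤ m ^ k * edgeCount G ^ (k * k) →
                c * n ^ k * (left G * right G) ^ (k * k) ≤ m ^ k * edges ^ (k * k)
  large m = subst (λ E → c * n ^ k * (left G * right G) ^ (k * k) ≤ m ^ k * E ^ (k * k)) edgeCount≡
  choice : ∃ λ (T : Vec (Fin (right G)) k) → c * (poorTuples T + n ^ k) ≤ 2 * length (common T) ^ k
  choice = dependent-random-choice k c 1≤k 1≤E′ (large (left G) aLarge) (large (right G) bLarge)
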